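{- Let $\mathbf{A}=((A,\sqsubseteq,\wedge,\vee),\{o_i\}_{i\in N},\{\otimes_i\}_{i\in N})$ be a complete distributive lattice-based algebra. Its canonical representation is defined to be the algebra $$\mathbf{A}^+=((A^+,\subseteq,\cap,\cup),\{o_i^+\}_{i\in N},\{\otimes_i^+\}_{i\in N}),$$ such that $o_i^+=(\downarrow^+ o_i\bigvee):A^+\to A^+$ and $\otimes_i^+=(\downarrow^+\otimes_i\bigvee):A^+\times A^+\to A^+$ are the unary and binary operators over sets in $A^+$; that is, $o_i^+(S)=\downarrow^+ o_i(\bigvee S)$ and $\otimes_i^+(S,T)=\downarrow^+\otimes_i(\bigvee S,\bigvee T)$ for $S,T\in A^+$.
   Context: A complete distributive lattice-based algebra is a complete distributive lattice $(A,\sqsubseteq,\wedge,\vee)$ extended with unary operators $o_i:A\to A$ and binary operators $\otimes_i:A\times A\to A$, $i\in N$. Let $0$ be the bottom element of $A$. For $x\in A$, $\downarrow x=\{a\in A\mid a\sqsubseteq x\}$. An element $x\neq 0$ of $A$ is join-irreducible iff $x=a\vee b$ implies $x=a$ or $x=b$, for any $a,b\in A$. Put $\widehat{A}=\{y\in A\mid y\text{ is join-irreducible}\}\cup\{0\}$, $\downarrow^+x=\downarrow x\cap\widehat{A}$ for $x\in A$, and $A^+=\{\downarrow^+a\mid a\in A\}\subseteq\mathcal{P}(A)$, where $\mathcal{P}(A)$ is the powerset of $A$. The map $\bigvee:A^+\to A$ takes a set in $A^+$ to its supremum in $A$. -}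

module Defs where

open import Algebra.Core using (Op₁; Op₂)
open import Algebra.Definitions using (Congruent₁; Congruent₂)
open import Data.Empty.Polymorphic using (⊥; ⊥-elim)
open import Data.Product.Base using (∃; _×_; _,_; proj₁; proj₂)
open import Data.Sum.Base using (_⊎_)
open import Function.Base using (_on_)
open import Level using (Level; _⊔_; suc)
open import Relation.Binary.Core using (Rel)
open import Relation.Binary.Lattice.Structures using (IsDistributiveLattice)
open import Relation.Nullary.Negation.Core using (¬_)
open import Relation.Unary using (Pred; _⊆_; _≐_; _∩_)

private
  variable
    a c i n ι ℓ₁ ℓ₂ : Level

module _ {A : Set a} (_≤_ : Rel A ℓ₂) where

  IsSup : {I : Set i} → (I → A) → A → Set (a ⊔ i ⊔ ℓ₂)
  IsSup f x = (∀ j → f j ≤ x) × (∀ y → (∀ j → f j ≤ y) → x ≤ y)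

  IsInf : {I : Set i} → (I → A) → A → Set (a ⊔ i ⊔ ℓ₂)
  IsInf f x = (∀ j → x ≤ f j) × (∀ y → (∀ j → y ≤ f j) → y ≤ x)

-- Completeness is stated for families indexed by types in Set ι.  A subset P
-- is the family proj₁ : ∃ P → A; families, unlike predicates, respect the
-- setoid equality for free.  "Complete distributive" means complete and
-- (finitely) distributive; no infinite distributive law is assumed.
record IsCompleteDistributiveLattice
  (ι : Level) {A : Set a} (_≈_ : Rel A ℓ₁) (_⊑_ : Rel A ℓ₂)
  (_∧_ _∨_ : Op₂ A) : Set (a ⊔ ℓ₁ ⊔ ℓ₂ ⊔ suc ι) where
  field
    isDistributiveLattice : IsDistributiveLattice _≈_ _⊑_ _∨_ _∧_
    sup : {I : Set ι} (f : I → A) → ∃ (IsSup _⊑_ f)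
    inf : {I : Set ι} (f : I → A) → ∃ (IsInf _⊑_ f)

  open IsDistributiveLattice isDistributiveLattice public

record IsCompleteDistributiveLatticeBasedAlgebra
  (ι : Level) {A : Set a} (_≈_ : Rel A ℓ₁) (_⊑_ : Rel A ℓ₂)
  (_∧_ _∨_ : Op₂ A) {N : Set n} (o : N → Op₁ A) (⊗ : N → Op₂ A)
  : Set (a ⊔ ℓ₁ ⊔ ℓ₂ ⊔ n ⊔ suc ι) where
  field
    isCompleteDistributiveLattice :
      IsCompleteDistributiveLattice ι _≈_ _⊑_ _∧_ _∨_
    o-cong : ∀ i → Congruent₁ _≈_ (o i)
    ⊗-cong : ∀ i → Congruent₂ _≈_ (⊗ i)

  open IsCompleteDistributiveLattice isCompleteDistributiveLattice public

record CompleteDistributiveLatticeBasedAlgebra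
  (c ℓ₁ ℓ₂ ι : Level) (N : Set n) : Set (suc (c ⊔ ℓ₁ ⊔ ℓ₂ ⊔ ι) ⊔ n) where
  infix  4 _≈_ _⊑_
  infixr 6 _∨_
  infixr 7 _∧_
  field
    Carrier : Set c
    _≈_     : Rel Carrier ℓ₁
    _⊑_     : Rel Carrier ℓ₂
    _∧_     : Op₂ Carrier
    _∨_     : Op₂ Carrier
    o       : N → Op₁ Carrier
    ⊗       : N → Op₂ Carrier
    isCompleteDistributiveLatticeBasedAlgebra :
      IsCompleteDistributiveLatticeBasedAlgebra ι _≈_ _⊑_ _∧_ _∨_ o ⊗

  open IsCompleteDistributiveLatticeBasedAlgebra
    isCompleteDistributiveLatticeBasedAlgebra public

  0# : Carrier
  0# = proj₁ (sup {I = ⊥} ⊥-elim)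

-- The level c ⊔ ℓ₁ ⊔ ℓ₂ is that of the predicates ↓⁺ a, so that sup applies
-- to every member of A⁺.
module CanonicalRepresentation {N : Set n}
  (𝐀 : CompleteDistributiveLatticeBasedAlgebra c ℓ₁ ℓ₂ (c ⊔ ℓ₁ ⊔ ℓ₂) N) where

  open CompleteDistributiveLatticeBasedAlgebra 𝐀

  Subset : Set (suc (c ⊔ ℓ₁ ⊔ ℓ₂))
  Subset = Pred Carrier (c ⊔ ℓ₁ ⊔ ℓ₂)

  JoinIrreducible : Pred Carrier (c ⊔ ℓ₁)
  JoinIrreducible x = ¬ (x ≈ 0#) × (∀ a b → x ≈ a ∨ b → x ≈ a ⊎ x ≈ b)

  Â : Pred Carrier (c ⊔ ℓ₁)
  Â y = JoinIrreducible y ⊎ y ≈ 0#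

  ↓ : Carrier → Pred Carrier ℓ₂
  ↓ x a = a ⊑ x

  ↓⁺ : Carrier → Subset
  ↓⁺ x = ↓ x ∩ Â

  InA⁺ : Pred Subset (c ⊔ ℓ₁ ⊔ ℓ₂)
  InA⁺ S = ∃ λ a → S ≐ ↓⁺ a

  A⁺ : Set (suc (c ⊔ ℓ₁ ⊔ ℓ₂))
  A⁺ = ∃ InA⁺

  -- Members of A⁺ are compared as sets: the witness in InA⁺ is ignored.
  _≐⁺_ : Rel A⁺ (c ⊔ ℓ₁ ⊔ ℓ₂)
  _≐⁺_ = _≐_ on proj₁

  _⊆⁺_ : Rel A⁺ (c ⊔ ℓ₁ ⊔ ℓ₂)
  _⊆⁺_ = _⊆_ on proj₁

  ↓⁺-in : Carrier → A⁺
  ↓⁺-in x = ↓⁺ x , x , (λ p → p) , (λ p → p)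

  ⋁ : A⁺ → Carrier
  ⋁ (S , _) = proj₁ (sup {I = ∃ S} proj₁)

  o⁺ : N → Op₁ A⁺
  o⁺ i S = ↓⁺-in (o i (⋁ S))

  ⊗⁺ : N → Op₂ A⁺
  ⊗⁺ i S T = ↓⁺-in (⊗ i (⋁ S) (⋁ T))

  ClosedUnder : Op₂ Subset → Set (suc (c ⊔ ℓ₁ ⊔ ℓ₂))
  ClosedUnder _∙_ = ∀ {S T} → InA⁺ S → InA⁺ T → InA⁺ (S ∙ T)

  restrict : (_∙_ : Op₂ Subset) → ClosedUnder _∙_ → Op₂ A⁺
  restrict _∙_ closed (S , p) (T , q) = (S ∙ T) , closed {S} {T} p q

{-# OPTIONS --safe #-}
-- A join-irreducible y ⊑ a ∨ b satisfies y = (y ∧ a) ∨ (y ∧ b), so it lies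
-- below a or below b; hence ↓⁺ turns joins into unions.  It turns arbitrary
-- infima into intersections, and suprema are infima of upper bounds.
module Submission where

open import Data.Product.Base using (Σ-syntax; ∃; _,_; proj₁; proj₂)
open import Data.Sum.Base as Sum using (_⊎_; inj₁; inj₂; [_,_])
open import Function.Base using (_∘_)
open import Level using (Level; _⊔_)
open import Relation.Binary.Lattice.Structures using (IsDistributiveLattice)
open import Relation.Unary using (_∈_; _⊆_; _≐_; _∩_; _∪_)
open import Relation.Unary.Properties using (≐-refl; ≐-sym; ≐-trans)
open import Defs

module _ {c ℓ₁ ℓ₂ n : Level} {N : Set n}
  (𝐀 : CompleteDistributiveLatticeBasedAlgebra c ℓ₁ ℓ₂ (c ⊔ ℓ₁ ⊔ ℓ₂) N) where

  open CompleteDistributiveLatticeBasedAlgebra 𝐀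
  open CanonicalRepresentation 𝐀

  Â-∨-prime : ∀ {y a b} → y ∈ Â → y ⊑ a ∨ b → y ⊑ a ⊎ y ⊑ b
  Â-∨-prime {y} {a} {b} (inj₁ (_ , irreducible)) y⊑a∨b =
    Sum.map (λ eq → trans (reflexive eq) (x∧y≤y y a))
            (λ eq → trans (reflexive eq) (x∧y≤y y b))
            (irreducible (y ∧ a) (y ∧ b) y≈)
    where
    y≈ : y ≈ (y ∧ a) ∨ (y ∧ b)
    y≈ = Eq.trans (antisym (∧-greatest refl y⊑a∨b) (x∧y≤x y (a ∨ b)))
                  (∧-distribˡ-∨ y a b)
  -- `0#` is the supremum of the empty family, so every element bounds it vacuously; taking the left
  -- disjunct is an arbitrary choice.
  Â-∨-prime {a = a} (inj₂ y≈0) _ =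
    inj₁ (trans (reflexive y≈0) (proj₂ (proj₂ (sup _)) a (λ ())))

  ↓⁺-mono : ∀ {a b} → a ⊑ b → ↓⁺ a ⊆ ↓⁺ b
  ↓⁺-mono a⊑b (x⊑a , x∈Â) = trans x⊑a a⊑b , x∈Â

  ↓⁺-cong : ∀ {a b} → a ≈ b → ↓⁺ a ≐ ↓⁺ b
  ↓⁺-cong a≈b = ↓⁺-mono (reflexive a≈b) , ↓⁺-mono (reflexive (Eq.sym a≈b))

  ∩-closed : ClosedUnder _∩_
  ∩-closed (a , S⊆ , S⊇) (b , T⊆ , T⊇) = a ∧ b ,
    (λ (x∈S , x∈T) → ∧-greatest (proj₁ (S⊆ x∈S)) (proj₁ (T⊆ x∈T)) , proj₂ (S⊆ x∈S)) ,
    (λ x∈ → S⊇ (↓⁺-mono (x∧y≤x a b) x∈) , T⊇ (↓⁺-mono (x∧y≤y a b) x∈))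

  -- One inclusion is monotonicity of `↓⁺`; only the converse needs primeness, to send each point
  -- below `a ∨ b` to one of the two sets.
  ∪-closed : ClosedUnder _∪_
  ∪-closed (a , S⊆ , S⊇) (b , T⊆ , T⊇) = a ∨ b ,
    [ ↓⁺-mono (x≤x∨y a b) ∘ S⊆ , ↓⁺-mono (y≤x∨y a b) ∘ T⊆ ] ,
    (λ (x⊑a∨b , x∈Â) → Sum.map (λ x⊑a → S⊇ (x⊑a , x∈Â)) (λ x⊑b → T⊇ (x⊑b , x∈Â))
                               (Â-∨-prime x∈Â x⊑a∨b))

  -- Order, meet and join are those of the powerset, so all laws are inherited; only closure depends
  -- on the algebra.
  A⁺-isDistributiveLattice : IsDistributiveLattice _≐⁺_ _⊆⁺_
    (restrict _∪_ ∪-closed) (restrict _∩_ ∩-closed)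
  A⁺-isDistributiveLattice = record
    { isLattice = record
      { isPartialOrder = record
        { isPreorder = record
          { isEquivalence = record
            { refl  = ≐-refl
            ; sym   = ≐-sym
            ; trans = ≐-trans
            }
          ; reflexive = proj₁
          ; trans     = λ S⊆T T⊆U x∈S → T⊆U (S⊆T x∈S)
          }
        ; antisym = _,_
        }
      ; supremum = λ _ _ → inj₁ , inj₂ , λ _ S⊆U T⊆U → [ S⊆U , T⊆U ]
      ; infimum  = λ _ _ → proj₁ , proj₂ , λ _ U⊆S U⊆T x∈U → U⊆S x∈U , U⊆T x∈U
      }
    ; ∧-distribˡ-∨ = λ _ _ _ →
        (λ (x∈S , x∈T∪U) → Sum.map (x∈S ,_) (x∈S ,_) x∈T∪U) ,
        [ (λ (x∈S , x∈T) → x∈S , inj₁ x∈T) , (λ (x∈S , x∈U) → x∈S , inj₂ x∈U) ]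
    }

  A⁺-inf : {I : Set (c ⊔ ℓ₁ ⊔ ℓ₂)} (f : I → A⁺) → ∃ (IsInf _⊆⁺_ f)
  A⁺-inf f with inf (λ j → proj₁ (proj₂ (f j)))
  ... | m , lower , greatest = ↓⁺-in m ,
    (λ j x∈ → proj₂ (proj₂ (proj₂ (f j))) (↓⁺-mono (lower j) x∈)) ,
    -- Membership in `Â` is read off `U` itself, since `I` may be empty and then no `f j` can supply
    -- it.
    (λ (_ , _ , U⊆ , _) bound x∈U →
      greatest _ (λ j → proj₁ (proj₁ (proj₂ (proj₂ (f j))) (bound j x∈U))) ,
      proj₂ (U⊆ x∈U))

  -- Upper bounds are indexed by b : Carrier with f j ⊆ ↓⁺ b, because A⁺ itself
  -- is too large to index an infimum.
  A⁺-sup : {I : Set (c ⊔ ℓ₁ ⊔ ℓ₂)} (f : I → A⁺) → ∃ (IsSup _⊆⁺_ f)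
  A⁺-sup f with inf {I = ∃ λ b → ∀ j → proj₁ (f j) ⊆ ↓⁺ b} proj₁
  ... | m , lower , greatest = ↓⁺-in m ,
    (λ j x∈ → greatest _ (λ (_ , bound) → proj₁ (bound j x∈)) ,
              proj₂ (proj₁ (proj₂ (proj₂ (f j))) x∈)) ,
    -- An upper bound in `A⁺` equals some `↓⁺ b`, and this `b` occurs in the family whose infimum is
    -- `m`, so `m ⊑ b`.
    (λ (_ , b , U⊆ , U⊇) bound x∈ →
      U⊇ (↓⁺-mono (lower (b , λ j x∈f → U⊆ (bound j x∈f))) x∈))

  ⋁-mono : ∀ S T → S ⊆⁺ T → ⋁ S ⊑ ⋁ T
  ⋁-mono _ _ S⊆T = proj₂ (proj₂ (sup _)) _
    (λ (x , x∈S) → proj₁ (proj₂ (sup _)) (x , S⊆T x∈S))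

  -- Equal sets still give families over different types `∃ S` and `∃ T`, so their chosen suprema
  -- are compared by antisymmetry. As `o⁺` and `⊗⁺` see their arguments only through `⋁`, this makes
  -- them respect equality of sets.
  ⋁-cong : ∀ S T → S ≐⁺ T → ⋁ S ≈ ⋁ T
  ⋁-cong S T (S⊆T , T⊆S) = antisym (⋁-mono S T S⊆T) (⋁-mono T S T⊆S)

  A⁺-isCompleteDistributiveLatticeBasedAlgebra :
    IsCompleteDistributiveLatticeBasedAlgebra (c ⊔ ℓ₁ ⊔ ℓ₂) _≐⁺_ _⊆⁺_
      (restrict _∩_ ∩-closed) (restrict _∪_ ∪-closed) o⁺ ⊗⁺
  A⁺-isCompleteDistributiveLatticeBasedAlgebra = record
    { isCompleteDistributiveLattice = record
      { isDistributiveLattice = A⁺-isDistributiveLattice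
      ; sup = A⁺-sup
      ; inf = A⁺-inf
      }
    ; o-cong = λ i {S} {T} S≐T → ↓⁺-cong (o-cong i (⋁-cong S T S≐T))
    ; ⊗-cong = λ i {S} {T} {U} {V} S≐T U≐V →
        ↓⁺-cong (⊗-cong i (⋁-cong S T S≐T) (⋁-cong U V U≐V))
    }

proposition3 : ∀ {c ℓ₁ ℓ₂ n : Level} {N : Set n}
    (𝐀 : CompleteDistributiveLatticeBasedAlgebra c ℓ₁ ℓ₂ (c ⊔ ℓ₁ ⊔ ℓ₂) N) →
    let open CanonicalRepresentation 𝐀 in
    Σ[ ∩-closed ∈ ClosedUnder _∩_ ]
    Σ[ ∪-closed ∈ ClosedUnder _∪_ ]
    IsCompleteDistributiveLatticeBasedAlgebra (c ⊔ ℓ₁ ⊔ ℓ₂) _≐⁺_ _⊆⁺_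
    (restrict _∩_ ∩-closed) (restrict _∪_ ∪-closed) o⁺ ⊗⁺
proposition3 𝐀 =
  ∩-closed 𝐀 , ∪-closed 𝐀 , A⁺-isCompleteDistributiveLatticeBasedAlgebra 𝐀
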